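{- Let $r\ge 2$ be an integer and let $G$ be a connected $r$-regular graph of order $n$. (i) If $G$ is not a Moore graph of degree $r$ and diameter $2$, then $$\gamma_{\times r}(G)\le \frac{r^2-1}{r^2}\,n .$$ (ii) If $G$ is a Moore graph of degree $r$ and diameter $2$ (so $n=r^2+1$), then $$\gamma_{\times r}(G)=\frac{r^2}{r^2+1}\,n=r^2 .$$
   Context: All graphs are finite and simple. For a vertex $v$, $N[v]=\{v\}\cup\{u\in V(G): uv\in E(G)\}$ is its closed neighborhood. For a positive integer $k$, a $k$-tuple dominating set of $G$ is a set $S\subseteq V(G)$ with $|N[v]\cap S|\ge k$ for every $v\in V(G)$; $\gamma_{\times k}(G)$ denotes the minimum cardinality of such a set. A Moore graph of degree $r$ and diameter $2$ is an $r$-regular graph of diameter $2$ with exactly $1+r+r(r-1)=r^2+1$ vertices. -}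

module Defs where

open import Data.Fin using (Fin)
open import Data.Fin.Subset using (Subset; ⁅_⁆; _∪_; _∩_; ∣_∣)
open import Data.Integer using (+_)
open import Data.Nat using (ℕ; suc; _+_; _^_; _≤_; NonZero; NonTrivial; nonTrivial⇒nonZero)
open import Data.Nat.Properties using (m^n≢0)
open import Data.Product using (∃-syntax; _×_)
open import Data.Rational using (ℚ; _/_)
open import Data.Vec using (tabulate)
open import Level using (0ℓ)
open import Relation.Binary using (Rel; Symmetric; Decidable)
open import Relation.Binary.PropositionalEquality using (_≡_)
open import Relation.Nullary using (¬_; does)

record Graph (n : ℕ) : Set₁ where
  field
    Adj     : Rel (Fin n) 0ℓ
    adj?    : Decidable Adj
    symm    : Symmetric Adj
    irrefl  : ∀ v → ¬ Adj v v

module _ {n : ℕ} (G : Graph n) where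
  open Graph G

  N⟨_⟩ : Fin n → Subset n
  N⟨ v ⟩ = tabulate (λ u → does (adj? v u))

  N[_] : Fin n → Subset n
  N[ v ] = ⁅ v ⁆ ∪ N⟨ v ⟩

  Regular : ℕ → Set
  Regular r = ∀ v → ∣ N⟨ v ⟩ ∣ ≡ r

  data Walk : ℕ → Fin n → Fin n → Set where
    []  : ∀ {v} → Walk 0 v v
    _∷_ : ∀ {k u v w} → Adj u v → Walk k v w → Walk (suc k) u w

  -- The graph without vertices is not connected.
  Connected : Set
  Connected = NonZero n × (∀ u v → ∃[ k ] Walk k u v)

  IsDistance : Fin n → Fin n → ℕ → Set
  IsDistance u v d = Walk d u v × (∀ {k} → Walk k u v → d ≤ k)

  -- The maximum of all distances exists and equals d; in particular every
  -- pair of vertices is at finite distance.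
  IsDiameter : ℕ → Set
  IsDiameter d = (∀ u v → ∃[ e ] (IsDistance u v e × e ≤ d))
               × (∃[ u ] ∃[ v ] IsDistance u v d)

  record IsMooreDiam2 (r : ℕ) : Set where
    field
      regular  : Regular r
      diameter : IsDiameter 2
      order    : n ≡ 1 + r ^ 2

  IsTupleDominating : ℕ → Subset n → Set
  IsTupleDominating k S = ∀ v → k ≤ ∣ N[ v ] ∩ S ∣

  -- γ is the minimum cardinality of a k-tuple dominating set.  This is a
  -- relation, not a function of G and k: if some closed neighbourhood has
  -- fewer than k elements, there is no such set and no such γ.
  IsTupleDominationNumber : ℕ → ℕ → Set
  IsTupleDominationNumber k γ =
      (∃[ S ] (IsTupleDominating k S × ∣ S ∣ ≡ γ))
    × (∀ S → IsTupleDominating k S → γ ≤ ∣ S ∣)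

fromℕ : ℕ → ℚ
fromℕ m = + m / 1

instance
  r²≢0 : ∀ {r} .{{_ : NonTrivial r}} → NonZero (r ^ 2)
  r²≢0 {r} = m^n≢0 r 2 {{nonTrivial⇒nonZero r}}

{-# OPTIONS --safe #-}

-- The complement T of an r-tuple dominating set S in an r-regular graph is a
-- packing: closed neighbourhoods have r + 1 elements, so S is dominating exactly
-- when no closed neighbourhood contains two vertices of T, i.e. when the vertices
-- of T are pairwise at distance at least 3.  Hence (i) asks for a packing T with
-- n ≤ r² |T|.  Balls of radius 2 have at most 1 + r² elements.  If the diameter is
-- at most 2, then n ≤ 1 + r², with equality only for a Moore graph, and a singleton
-- will do.  Otherwise there are two vertices at distance exactly 3; the interior
-- vertices of a path u - a - b - y lie in both balls, so these cover at most 2r²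
-- vertices.  As long as some vertex is not covered, connectedness yields an uncovered
-- vertex adjacent to a covered one; adding it to T covers at most r² new vertices.
module Submission where

open import Defs
open import Data.Empty using (⊥-elim)
open import Data.Fin using (Fin; zero; suc)
open import Data.Fin.Properties using (_≟_; any?; all?)
open import Data.Fin.Subset using (Subset; inside; outside; _∈_; _∉_; _⊆_; _⊂_; _⊃_; Nonempty; ⊤; ⊥; ⁅_⁆; ∁; _∪_; _∩_; _-_; ∣_∣)
open import Data.Fin.Subset.Induction using (⊃-wellFounded)
open import Data.Fin.Subset.Properties
import Data.Nat as Nat
open import Data.Nat as ℕ using (ℕ; zero; suc; _+_; _^_; NonZero; NonTrivial; nonTrivial⇒n>1; z≤n; s≤s)
open import Data.Nat.Induction using (<-wellFounded)
open import Data.Nat.Properties as ℕP using (module ≤-Reasoning)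
open import Data.Product using (∃; ∃-syntax; _×_; _,_; proj₁; proj₂)
open import Data.Rational.Properties using (toℚᵘ-cancel-≤; toℚᵘ-injective; toℚᵘ-homo-*; toℚᵘ-fromℚᵘ)
open import Data.Rational.Unnormalised as ℚᵘ using (*≤*; *≡*)
import Data.Rational.Unnormalised.Properties as ℚᵘP
open import Data.Sum using (_⊎_; inj₁; inj₂)
open import Data.Vec using ([]; _∷_; here; there)
open import Data.Vec.Properties using (lookup∘tabulate; []=⇒lookup; lookup⇒[]=)
open import Function using (_∘_)
open import Induction.WellFounded using (Acc; acc)
open import Relation.Binary.PropositionalEquality using (_≡_; _≢_; refl; sym; trans; cong; cong₂; subst; subst₂)
open import Relation.Nullary using (¬_; yes; no; does)
open import Relation.Nullary.Decidable using (_×-dec_; dec-true)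
open import Relation.Unary using (Pred; Decidable)

-- Cardinalities of finite subsets

module _ where
  open Nat using (_≤_; _*_)

  ∣p∪q∣+∣p∩q∣≡∣p∣+∣q∣ : ∀ {n} (p q : Subset n) → ∣ p ∪ q ∣ + ∣ p ∩ q ∣ ≡ ∣ p ∣ + ∣ q ∣
  ∣p∪q∣+∣p∩q∣≡∣p∣+∣q∣ []            []            = refl
  ∣p∪q∣+∣p∩q∣≡∣p∣+∣q∣ (outside ∷ p) (outside ∷ q) = ∣p∪q∣+∣p∩q∣≡∣p∣+∣q∣ p q
  ∣p∪q∣+∣p∩q∣≡∣p∣+∣q∣ (inside  ∷ p) (outside ∷ q) = cong suc (∣p∪q∣+∣p∩q∣≡∣p∣+∣q∣ p q)
  ∣p∪q∣+∣p∩q∣≡∣p∣+∣q∣ (outside ∷ p) (inside  ∷ q) =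
    trans (cong suc (∣p∪q∣+∣p∩q∣≡∣p∣+∣q∣ p q)) (sym (ℕP.+-suc ∣ p ∣ ∣ q ∣))
  ∣p∪q∣+∣p∩q∣≡∣p∣+∣q∣ (inside  ∷ p) (inside  ∷ q) =
    cong suc (trans (ℕP.+-suc ∣ p ∪ q ∣ ∣ p ∩ q ∣)
      (trans (cong suc (∣p∪q∣+∣p∩q∣≡∣p∣+∣q∣ p q)) (sym (ℕP.+-suc ∣ p ∣ ∣ q ∣))))

  ∣p∩q∣+∣p∩∁q∣≡∣p∣ : ∀ {n} (p q : Subset n) → ∣ p ∩ q ∣ + ∣ p ∩ ∁ q ∣ ≡ ∣ p ∣
  ∣p∩q∣+∣p∩∁q∣≡∣p∣ []            []            = refl
  ∣p∩q∣+∣p∩∁q∣≡∣p∣ (outside ∷ p) (_       ∷ q) = ∣p∩q∣+∣p∩∁q∣≡∣p∣ p q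
  ∣p∩q∣+∣p∩∁q∣≡∣p∣ (inside  ∷ p) (inside  ∷ q) = cong suc (∣p∩q∣+∣p∩∁q∣≡∣p∣ p q)
  ∣p∩q∣+∣p∩∁q∣≡∣p∣ (inside  ∷ p) (outside ∷ q) =
    trans (ℕP.+-suc ∣ p ∩ q ∣ ∣ p ∩ ∁ q ∣) (cong suc (∣p∩q∣+∣p∩∁q∣≡∣p∣ p q))

  ∣p∪q∣≤∣p∣+∣q∣ : ∀ {n} (p q : Subset n) → ∣ p ∪ q ∣ ≤ ∣ p ∣ + ∣ q ∣
  ∣p∪q∣≤∣p∣+∣q∣ p q = ℕP.≤-trans (ℕP.m≤m+n ∣ p ∪ q ∣ ∣ p ∩ q ∣) (ℕP.≤-reflexive (∣p∪q∣+∣p∩q∣≡∣p∣+∣q∣ p q))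

  ∣p∣+∣∁p∣≡n : ∀ {n} (p : Subset n) → ∣ p ∣ + ∣ ∁ p ∣ ≡ n
  ∣p∣+∣∁p∣≡n p = trans (cong (∣ p ∣ +_) (∣∁p∣≡n∸∣p∣ p)) (ℕP.m+[n∸m]≡n (∣p∣≤n p))

  x∈p⇒1≤∣p∣ : ∀ {n} {p : Subset n} {x} → x ∈ p → 1 ≤ ∣ p ∣
  x∈p⇒1≤∣p∣ x∈p = ℕP.≤-trans (s≤s z≤n) (x∈p⇒∣p-x∣<∣p∣ x∈p)

  x≢y∈p⇒2≤∣p∣ : ∀ {n} {p : Subset n} {x y} → x ∈ p → y ∈ p → x ≢ y → 2 ≤ ∣ p ∣
  x≢y∈p⇒2≤∣p∣ x∈p y∈p x≢y =
    ℕP.≤-trans (s≤s (x∈p⇒1≤∣p∣ (x∈p∧x≢y⇒x∈p-y y∈p (x≢y ∘ sym)))) (x∈p⇒∣p-x∣<∣p∣ x∈p)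

  subsingleton⇒∣p∣≤1 : ∀ {n} (p : Subset n) → (∀ {x y} → x ∈ p → y ∈ p → x ≡ y) → ∣ p ∣ ≤ 1
  subsingleton⇒∣p∣≤1 {n} p p-prop with nonempty? p
  ... | yes (x , x∈p) = subst (∣ p ∣ ≤_) (∣⁅x⁆∣≡1 x)
    (p⊆q⇒∣p∣≤∣q∣ λ y∈p → subst (_∈ ⁅ x ⁆) (p-prop x∈p y∈p) (x∈⁅x⁆ x))
  ... | no p-empty = subst (_≤ 1) (sym (trans (cong ∣_∣ (Empty-unique p-empty)) (∣⊥∣≡0 n))) z≤n

  all-∈⇒n≤∣p∣ : ∀ {n} {p : Subset n} → (∀ x → x ∈ p) → n ≤ ∣ p ∣
  all-∈⇒n≤∣p∣ {n} {p} all∈ = subst (_≤ ∣ p ∣) (∣⊤∣≡n n) (p⊆q⇒∣p∣≤∣q∣ {p = ⊤} λ {x} _ → all∈ x)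

  -- Unions indexed by a subset

  ⋃[_]_ : ∀ {m n} → Subset m → (Fin m → Subset n) → Subset n
  ⋃[ []          ] f = ⊥
  ⋃[ inside  ∷ p ] f = f zero ∪ ⋃[ p ] (f ∘ suc)
  ⋃[ outside ∷ p ] f = ⋃[ p ] (f ∘ suc)

  x∈⋃⁺ : ∀ {m n} {p : Subset m} (f : Fin m → Subset n) {i x} → i ∈ p → x ∈ f i → x ∈ ⋃[ p ] f
  x∈⋃⁺ f here x∈ = x∈p∪q⁺ (inj₁ x∈)
  x∈⋃⁺ {p = inside  ∷ p} f (there i∈p) x∈ = x∈p∪q⁺ (inj₂ (x∈⋃⁺ (f ∘ suc) i∈p x∈))
  x∈⋃⁺ {p = outside ∷ p} f (there i∈p) x∈ = x∈⋃⁺ (f ∘ suc) i∈p x∈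

  x∈⋃⁻ : ∀ {m n} (p : Subset m) (f : Fin m → Subset n) {x} → x ∈ ⋃[ p ] f → ∃[ i ] (i ∈ p × x ∈ f i)
  x∈⋃⁻ [] f x∈ = ⊥-elim (∉⊥ x∈)
  x∈⋃⁻ (inside ∷ p) f x∈ with x∈p∪q⁻ (f zero) (⋃[ p ] (f ∘ suc)) x∈
  ... | inj₁ x∈f0 = zero , here , x∈f0
  ... | inj₂ x∈⋃ = let i , i∈p , x∈fi = x∈⋃⁻ p (f ∘ suc) x∈⋃ in suc i , there i∈p , x∈fi
  x∈⋃⁻ (outside ∷ p) f x∈ = let i , i∈p , x∈fi = x∈⋃⁻ p (f ∘ suc) x∈ in suc i , there i∈p , x∈fi

  ∣⋃∣≤∣p∣*k : ∀ {m n k} (p : Subset m) (f : Fin m → Subset n) →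
    (∀ {i} → i ∈ p → ∣ f i ∣ ≤ k) → ∣ ⋃[ p ] f ∣ ≤ ∣ p ∣ * k
  ∣⋃∣≤∣p∣*k {n = n} [] f f≤k = ℕP.≤-reflexive (∣⊥∣≡0 n)
  ∣⋃∣≤∣p∣*k (inside ∷ p) f f≤k = ℕP.≤-trans (∣p∪q∣≤∣p∣+∣q∣ (f zero) (⋃[ p ] (f ∘ suc)))
    (ℕP.+-mono-≤ (f≤k here) (∣⋃∣≤∣p∣*k p (f ∘ suc) (f≤k ∘ there)))
  ∣⋃∣≤∣p∣*k (outside ∷ p) f f≤k = ∣⋃∣≤∣p∣*k p (f ∘ suc) (f≤k ∘ there)

  -- Descent on cardinality: `anySubset?` either finds a strictly smaller subset satisfying `P` or
  -- shows that there is none.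
  smallestSubset : ∀ {n ℓ} {P : Pred (Subset n) ℓ} → Decidable P → ∃ P →
    ∃[ S ] (P S × (∀ S′ → P S′ → ∣ S ∣ ≤ ∣ S′ ∣))
  smallestSubset {P = P} P? (S₀ , PS₀) = go S₀ PS₀ (<-wellFounded ∣ S₀ ∣)
    where
    go : ∀ S → P S → Acc ℕ._<_ ∣ S ∣ → ∃[ S ] (P S × (∀ S′ → P S′ → ∣ S ∣ ≤ ∣ S′ ∣))
    go S PS (acc smaller) with anySubset? (λ S′ → P? S′ ×-dec (∣ S′ ∣ ℕ.<? ∣ S ∣))
    ... | yes (S′ , PS′ , S′<S) = go S′ PS′ (smaller S′<S)
    ... | no minimal = S , PS , λ S′ PS′ → ℕP.≮⇒≥ λ S′<S → minimal (S′ , PS′ , S′<S)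

-- Packings

module _ {n : ℕ} (G : Graph n) where
  open Graph G
  open Nat using (_≤_; _*_)

  private
    N : Fin n → Subset n
    N = N[_] G

    N° : Fin n → Subset n
    N° = N⟨_⟩ G

  Adj⇒∈N° : ∀ {u v} → Adj v u → u ∈ N° v
  Adj⇒∈N° {u} {v} a = lookup⇒[]= u (N° v)
    (trans (lookup∘tabulate (λ u → does (adj? v u)) u) (dec-true (adj? v u) a))

  ∈N°⇒Adj : ∀ {u v} → u ∈ N° v → Adj v u
  -- Abstracting the equation together with `adj? v u` turns it into `false ≡ true` in the `no`
  -- case.
  ∈N°⇒Adj {u} {v} u∈ with adj? v u | trans (sym (lookup∘tabulate (λ u → does (adj? v u)) u)) ([]=⇒lookup u∈)
  ... | yes a | _ = a
  ... | no _  | ()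

  v∈N[v] : ∀ v → v ∈ N v
  v∈N[v] v = x∈p∪q⁺ (inj₁ (x∈⁅x⁆ v))

  Adj⇒∈N : ∀ {u v} → Adj v u → u ∈ N v
  Adj⇒∈N a = x∈p∪q⁺ (inj₂ (Adj⇒∈N° a))

  ∈N⇒≡⊎Adj : ∀ {u v} → u ∈ N v → u ≡ v ⊎ Adj v u
  ∈N⇒≡⊎Adj {u} {v} u∈ with x∈p∪q⁻ ⁅ v ⁆ (N° v) u∈
  ... | inj₁ u∈⁅v⁆ = inj₁ (x∈⁅y⁆⇒x≡y v u∈⁅v⁆)
  ... | inj₂ u∈N°  = inj₂ (∈N°⇒Adj u∈N°)

  ∈N-sym : ∀ {u v} → u ∈ N v → v ∈ N u
  ∈N-sym {u} {v} u∈ with ∈N⇒≡⊎Adj u∈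
  ... | inj₁ refl = v∈N[v] v
  ... | inj₂ a    = Adj⇒∈N (symm a)

  -- Distance at most 2.
  Near : Fin n → Fin n → Set
  Near u v = ∃[ w ] (u ∈ N w × v ∈ N w)

  Near-sym : ∀ {u v} → Near u v → Near v u
  Near-sym (w , u∈ , v∈) = w , v∈ , u∈

  -- Ending in an equality, this gives at once that the part of `T` inside any `N w` is a
  -- subsingleton.
  Packing : Subset n → Set
  Packing T = ∀ {x y} → x ∈ T → y ∈ T → Near x y → x ≡ y

  Packing-⁅⁆ : ∀ v → Packing ⁅ v ⁆
  Packing-⁅⁆ v x∈ y∈ _ = trans (x∈⁅y⁆⇒x≡y v x∈) (sym (x∈⁅y⁆⇒x≡y v y∈))

  Packing-∪⁅⁆ : ∀ {T y} → Packing T → (∀ {t} → t ∈ T → ¬ Near t y) → Packing (T ∪ ⁅ y ⁆)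
  Packing-∪⁅⁆ {T} {y} packing far {a} {b} a∈ b∈ near
    with x∈p∪q⁻ T ⁅ y ⁆ a∈ | x∈p∪q⁻ T ⁅ y ⁆ b∈
  ... | inj₁ a∈T | inj₁ b∈T = packing a∈T b∈T near
  ... | inj₁ a∈T | inj₂ b∈y = ⊥-elim (far a∈T (subst (Near a) (x∈⁅y⁆⇒x≡y y b∈y) near))
  ... | inj₂ a∈y | inj₁ b∈T = ⊥-elim (far b∈T (subst (Near b) (x∈⁅y⁆⇒x≡y y a∈y) (Near-sym near)))
  ... | inj₂ a∈y | inj₂ b∈y = trans (x∈⁅y⁆⇒x≡y y a∈y) (sym (x∈⁅y⁆⇒x≡y y b∈y))

  -- Each N w contains v; leaving it out makes the cardinality bound 1 + r² immediate.
  Ball : Fin n → Subset n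
  Ball v = ⁅ v ⁆ ∪ ⋃[ N° v ] (λ w → N w - v)

  Near⇒∈Ball : ∀ {u v} → Near u v → v ∈ Ball u
  Near⇒∈Ball {u} {v} (w , u∈ , v∈) with v ≟ u
  ... | yes refl = x∈p∪q⁺ (inj₁ (x∈⁅x⁆ v))
  ... | no v≢u with ∈N⇒≡⊎Adj u∈
  ...   | inj₂ a = x∈p∪q⁺ (inj₂ (x∈⋃⁺ _ (Adj⇒∈N° (symm a)) (x∈p∧x≢y⇒x∈p-y v∈ v≢u)))
  ...   | inj₁ refl with ∈N⇒≡⊎Adj v∈
  ...     | inj₁ v≡u = ⊥-elim (v≢u v≡u)
  -- The common vertex is `u` itself, so `v` is a neighbour of `u` and serves as its own
  -- intermediate vertex.
  ...     | inj₂ a = x∈p∪q⁺ (inj₂ (x∈⋃⁺ _ (Adj⇒∈N° a) (x∈p∧x≢y⇒x∈p-y (v∈N[v] v) v≢u)))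

  ∈Ball⇒Near : ∀ {u v} → v ∈ Ball u → Near u v
  ∈Ball⇒Near {u} {v} v∈ with x∈p∪q⁻ ⁅ u ⁆ _ v∈
  ... | inj₁ v∈⁅u⁆ = u , v∈N[v] u , subst (_∈ N u) (sym (x∈⁅y⁆⇒x≡y u v∈⁅u⁆)) (v∈N[v] u)
  ... | inj₂ v∈⋃ = let w , w∈ , v∈- = x∈⋃⁻ (N° u) _ v∈⋃ in
    w , Adj⇒∈N (symm (∈N°⇒Adj w∈)) , p─q⊆p (N w) ⁅ u ⁆ v∈-

  v∈Ball[v] : ∀ v → v ∈ Ball v
  v∈Ball[v] v = x∈p∪q⁺ (inj₁ (x∈⁅x⁆ v))

  Cover : Subset n → Subset n
  Cover T = ⋃[ T ] Ball

  T⊆Cover : ∀ {T} → T ⊆ Cover T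
  T⊆Cover t∈T = x∈⋃⁺ Ball t∈T (v∈Ball[v] _)

  -- `T` lies in its own cover, so `y` is new. Strictness drives the recursion of `extend` and pays
  -- for the extra `r ^ 2` in `efficient-∪⁅⁆`.
  y∉Cover⇒T⊂T∪⁅y⁆ : ∀ {T y} → y ∉ Cover T → T ⊂ T ∪ ⁅ y ⁆
  y∉Cover⇒T⊂T∪⁅y⁆ {T} {y} y∉C = p⊆p∪q ⁅ y ⁆ , y , q⊆p∪q T ⁅ y ⁆ (x∈⁅x⁆ y) , y∉C ∘ T⊆Cover

  Cover-∪⁅⁆⊆ : ∀ {T y} → Cover (T ∪ ⁅ y ⁆) ⊆ Cover T ∪ Ball y
  Cover-∪⁅⁆⊆ {T} {y} {x} x∈ with x∈⋃⁻ (T ∪ ⁅ y ⁆) Ball x∈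
  ... | t , t∈ , x∈Ball with x∈p∪q⁻ T ⁅ y ⁆ t∈
  ...   | inj₁ t∈T = x∈p∪q⁺ (inj₁ (x∈⋃⁺ Ball t∈T x∈Ball))
  ...   | inj₂ t∈y = x∈p∪q⁺ (inj₂ (subst (λ t → x ∈ Ball t) (x∈⁅y⁆⇒x≡y y t∈y) x∈Ball))

  -- Testing each next vertex for membership in `C` finds the first step of the walk out of `C`.
  leaving-edge : ∀ {k u v} (C : Subset n) → Walk G k u v → u ∈ C → v ∉ C →
    ∃[ x ] ∃[ y ] (x ∈ C × y ∉ C × Adj x y)
  leaving-edge C [] u∈C v∉C = ⊥-elim (v∉C u∈C)
  leaving-edge C (_∷_ {u = u} {v = w} a walk) u∈C v∉C with w ∈? C
  ... | yes w∈C = leaving-edge C walk w∈C v∉C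
  ... | no w∉C  = u , w , u∈C , w∉C , a

  -- If the common `w` were one of the endpoints, `v` would lie in `N u`; so `w` is the middle of a
  -- walk of length 2. Shorter walks would also put `v` in `N u`.
  isDistance-2 : ∀ {u v} → Near u v → v ∉ N u → IsDistance G u v 2
  isDistance-2 {u} {v} (w , u∈ , v∈) v∉N = walk , bound
    where
    walk : Walk G 2 u v
    walk with ∈N⇒≡⊎Adj u∈ | ∈N⇒≡⊎Adj v∈
    ... | inj₁ refl | _         = ⊥-elim (v∉N v∈)
    ... | inj₂ _    | inj₁ refl = ⊥-elim (v∉N (∈N-sym u∈))
    ... | inj₂ a    | inj₂ b    = symm a ∷ (b ∷ [])

    bound : ∀ {k} → Walk G k u v → 2 ≤ k
    bound []           = ⊥-elim (v∉N (v∈N[v] u))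
    bound (a ∷ [])     = ⊥-elim (v∉N (Adj⇒∈N a))
    bound (_ ∷ _ ∷ _)  = s≤s (s≤s z≤n)

  -- `IsDiameter` asks for exact distances, so equality and adjacency are split off from distance 2.
  Near⇒distance≤2 : ∀ {u v} → Near u v → ∃[ e ] (IsDistance G u v e × e ≤ 2)
  Near⇒distance≤2 {u} {v} near with v ∈? N u
  ... | no v∉N = 2 , isDistance-2 near v∉N , ℕP.≤-refl
  ... | yes v∈N with ∈N⇒≡⊎Adj v∈N
  ...   | inj₁ refl = 0 , ([] , λ _ → z≤n) , z≤n
  ...   | inj₂ a = 1 , (a ∷ [] , λ { [] → ⊥-elim (irrefl u a) ; (_ ∷ _) → s≤s z≤n }) , s≤s z≤n

  Walk≤2⇒Near : ∀ {u v k} → k ≤ 2 → Walk G k u v → Near u v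
  Walk≤2⇒Near {u} _ [] = u , v∈N[v] u , v∈N[v] u
  Walk≤2⇒Near {u} _ (a ∷ []) = u , v∈N[v] u , Adj⇒∈N a
  Walk≤2⇒Near _ (_∷_ {v = w} a (b ∷ [])) = w , Adj⇒∈N (symm a) , Adj⇒∈N b
  Walk≤2⇒Near (s≤s (s≤s ())) (_ ∷ _ ∷ _ ∷ _)

  -- Dominating sets of regular graphs as complements of packings

  module _ {r : ℕ} (regular : Regular G r) where

    ∣N∣≡1+r : ∀ v → ∣ N v ∣ ≡ 1 + r
    ∣N∣≡1+r v = begin
      ∣ N v ∣                         ≡⟨ ℕP.+-identityʳ _ ⟨
      ∣ N v ∣ + 0                     ≡⟨ cong (∣ N v ∣ +_) (trans (cong ∣_∣ (Empty-unique disjoint)) (∣⊥∣≡0 n)) ⟨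
      ∣ N v ∣ + ∣ ⁅ v ⁆ ∩ N° v ∣      ≡⟨ ∣p∪q∣+∣p∩q∣≡∣p∣+∣q∣ ⁅ v ⁆ (N° v) ⟩
      ∣ ⁅ v ⁆ ∣ + ∣ N° v ∣            ≡⟨ cong₂ _+_ (∣⁅x⁆∣≡1 v) (regular v) ⟩
      1 + r                           ∎
      where
      open Relation.Binary.PropositionalEquality.≡-Reasoning
      disjoint : ¬ Nonempty (⁅ v ⁆ ∩ N° v)
      disjoint (x , x∈) with x∈p∩q⁻ ⁅ v ⁆ (N° v) x∈
      ... | x∈⁅v⁆ , x∈N° with x∈⁅y⁆⇒x≡y v x∈⁅v⁆
      ... | refl = irrefl v (∈N°⇒Adj x∈N°)

    -- Two vertices outside `S` in one `N w`, besides the `r` or more inside `S`, would exceed its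
    -- `1 + r` elements.
    dominating⇒packing : ∀ {S} → IsTupleDominating G r S → Packing (∁ S)
    dominating⇒packing {S} dom {x} {y} x∉S y∉S (w , x∈N , y∈N) with x ≟ y
    ... | yes x≡y = x≡y
    ... | no x≢y = ⊥-elim (ℕP.1+n≰n (begin
      2 + r                          ≡⟨ ℕP.+-comm 2 r ⟩
      r + 2                          ≤⟨ ℕP.+-mono-≤ (dom w) (x≢y∈p⇒2≤∣p∣ (x∈p∩q⁺ (x∈N , x∉S)) (x∈p∩q⁺ (y∈N , y∉S)) x≢y) ⟩
      ∣ N w ∩ S ∣ + ∣ N w ∩ ∁ S ∣    ≡⟨ ∣p∩q∣+∣p∩∁q∣≡∣p∣ (N w) S ⟩
      ∣ N w ∣                        ≡⟨ ∣N∣≡1+r w ⟩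
      1 + r                          ∎))
      where open ≤-Reasoning

    -- At most one of the `1 + r` elements of `N w` lies in `T`, which leaves `r` for the
    -- complement.
    packing⇒dominating : ∀ {T} → Packing T → IsTupleDominating G r (∁ T)
    packing⇒dominating {T} packing w = ℕP.+-cancelˡ-≤ 1 _ _ (begin
      1 + r                          ≡⟨ ∣N∣≡1+r w ⟨
      ∣ N w ∣                        ≡⟨ ∣p∩q∣+∣p∩∁q∣≡∣p∣ (N w) T ⟨
      ∣ N w ∩ T ∣ + ∣ N w ∩ ∁ T ∣    ≤⟨ ℕP.+-monoˡ-≤ _ (subsingleton⇒∣p∣≤1 (N w ∩ T) N∩T-prop) ⟩
      1 + ∣ N w ∩ ∁ T ∣              ∎)
      where
      open ≤-Reasoning
      N∩T-prop : ∀ {x y} → x ∈ N w ∩ T → y ∈ N w ∩ T → x ≡ y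
      N∩T-prop x∈ y∈ =
        let x∈N , x∈T = x∈p∩q⁻ (N w) T x∈
            y∈N , y∈T = x∈p∩q⁻ (N w) T y∈
        in packing x∈T y∈T (w , x∈N , y∈N)

    ∣Ball∣≤1+r² : ∀ v → ∣ Ball v ∣ ≤ 1 + r ^ 2
    ∣Ball∣≤1+r² v = begin
      ∣ Ball v ∣                                    ≤⟨ ∣p∪q∣≤∣p∣+∣q∣ ⁅ v ⁆ _ ⟩
      ∣ ⁅ v ⁆ ∣ + ∣ ⋃[ N° v ] (λ w → N w - v) ∣     ≤⟨ ℕP.+-mono-≤ (ℕP.≤-reflexive (∣⁅x⁆∣≡1 v)) (∣⋃∣≤∣p∣*k (N° v) _ ∣N-v∣≤r) ⟩
      1 + ∣ N° v ∣ * r                              ≡⟨ cong (λ d → 1 + d * r) (regular v) ⟩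
      1 + r * r                                     ≡⟨ cong (λ m → 1 + r * m) (ℕP.*-identityʳ r) ⟨
      1 + r ^ 2                                     ∎
      where
      open ≤-Reasoning
      ∣N-v∣≤r : ∀ {w} → w ∈ N° v → ∣ N w - v ∣ ≤ r
      ∣N-v∣≤r {w} w∈ = ℕP.≤-pred (subst (suc ∣ N w - v ∣ ≤_) (∣N∣≡1+r w)
        (x∈p⇒∣p-x∣<∣p∣ (Adj⇒∈N (symm (∈N°⇒Adj w∈)))))

    -- Growing a packing in a connected regular graph

    module _ (connected : ∀ u v → ∃[ k ] Walk G k u v) where

      -- The invariant of the construction. A ball may have `1 + r ^ 2` elements, so a singleton can
      -- fail it; hence the start from a pair.
      Efficient : Subset n → Set
      Efficient T = Packing T × ∣ Cover T ∣ ≤ ∣ T ∣ * r ^ 2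

      efficient-∪⁅⁆ : ∀ {T x y} → Efficient T → x ∈ Cover T → y ∉ Cover T → Adj x y → Efficient (T ∪ ⁅ y ⁆)
      efficient-∪⁅⁆ {T} {x} {y} (packing , small) x∈C y∉C a =
        Packing-∪⁅⁆ packing (λ t∈T near → y∉C (x∈⋃⁺ Ball t∈T (Near⇒∈Ball near))) ,
        (begin
          ∣ Cover (T ∪ ⁅ y ⁆) ∣     ≤⟨ p⊆q⇒∣p∣≤∣q∣ (Cover-∪⁅⁆⊆ {T} {y}) ⟩
          ∣ Cover T ∪ Ball y ∣      ≤⟨ ℕP.+-cancelʳ-≤ 1 _ _ union-bound ⟩
          ∣ Cover T ∣ + r ^ 2       ≤⟨ ℕP.+-monoˡ-≤ _ small ⟩
          ∣ T ∣ * r ^ 2 + r ^ 2     ≡⟨ ℕP.+-comm _ (r ^ 2) ⟩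
          suc ∣ T ∣ * r ^ 2         ≤⟨ ℕP.*-monoˡ-≤ (r ^ 2) (p⊂q⇒∣p∣<∣q∣ (y∉Cover⇒T⊂T∪⁅y⁆ {T} y∉C)) ⟩
          ∣ T ∪ ⁅ y ⁆ ∣ * r ^ 2     ∎)
        where
        open ≤-Reasoning

        -- The overlap is carried as `+ 1` on both sides, which avoids truncated subtraction.
        union-bound : ∣ Cover T ∪ Ball y ∣ + 1 ≤ ∣ Cover T ∣ + r ^ 2 + 1
        union-bound = begin
          ∣ Cover T ∪ Ball y ∣ + 1                       ≤⟨ ℕP.+-monoʳ-≤ _ (x∈p⇒1≤∣p∣ (x∈p∩q⁺ (x∈C , Near⇒∈Ball (x , Adj⇒∈N a , v∈N[v] x)))) ⟩
          ∣ Cover T ∪ Ball y ∣ + ∣ Cover T ∩ Ball y ∣    ≡⟨ ∣p∪q∣+∣p∩q∣≡∣p∣+∣q∣ (Cover T) (Ball y) ⟩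
          ∣ Cover T ∣ + ∣ Ball y ∣                       ≤⟨ ℕP.+-monoʳ-≤ _ (∣Ball∣≤1+r² y) ⟩
          ∣ Cover T ∣ + (1 + r ^ 2)                      ≡⟨ cong (∣ Cover T ∣ +_) (ℕP.+-comm 1 (r ^ 2)) ⟩
          ∣ Cover T ∣ + (r ^ 2 + 1)                      ≡⟨ ℕP.+-assoc _ (r ^ 2) 1 ⟨
          ∣ Cover T ∣ + r ^ 2 + 1                        ∎

      -- The member `t` is a covered vertex from which to walk to an uncovered one. Subsets of a
      -- finite set cannot grow forever, so the recursion ends.
      extend : ∀ {T t} → Acc _⊃_ T → t ∈ T → Efficient T → ∃[ T′ ] (Packing T′ × n ≤ ∣ T′ ∣ * r ^ 2)
      extend {T} {t} (acc larger) t∈T eff with nonempty? (∁ (Cover T))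
      ... | no full = T , proj₁ eff ,
        ℕP.≤-trans (all-∈⇒n≤∣p∣ λ x → x∉∁p⇒x∈p λ x∈∁ → full (x , x∈∁)) (proj₂ eff)
      ... | yes (z , z∈∁) =
        let x , y , x∈C , y∉C , a = leaving-edge (Cover T) (proj₂ (connected t z)) (T⊆Cover t∈T) (x∈∁p⇒x∉p z∈∁)
        in extend (larger (y∉Cover⇒T⊂T∪⁅y⁆ y∉C))
             (p⊆p∪q ⁅ y ⁆ t∈T) (efficient-∪⁅⁆ eff x∈C y∉C a)

      -- The second vertex is not `v`, whose ball may miss `Ball u`, but the first vertex `y`
      -- outside `Ball u` on the way to `v`. With `x` before `y` and `w` between `u` and `x`, both
      -- balls contain `w` and `x`, so their union has at most `2 * (1 + r ^ 2) - 2` elements.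
      efficient-pair : ∀ {u v} → ¬ Near u v → ∃[ y ] Efficient (⁅ u ⁆ ∪ ⁅ y ⁆)
      efficient-pair {u} {v} far
        with leaving-edge (Ball u) (proj₂ (connected u v)) (v∈Ball[v] u) (far ∘ ∈Ball⇒Near)
      ... | x , y , x∈B , y∉B , a with ∈Ball⇒Near x∈B
      ... | w , u∈Nw , x∈Nw = y ,
        Packing-∪⁅⁆ (Packing-⁅⁆ u) (λ { t∈ near → y∉B (Near⇒∈Ball (subst (λ t → Near t y) (x∈⁅y⁆⇒x≡y u t∈) near)) }) ,
        (begin
          ∣ Cover (⁅ u ⁆ ∪ ⁅ y ⁆) ∣     ≤⟨ p⊆q⇒∣p∣≤∣q∣ covered ⟩
          ∣ Ball u ∪ Ball y ∣           ≤⟨ ℕP.+-cancelʳ-≤ 2 _ _ union-bound ⟩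
          2 * r ^ 2                     ≤⟨ ℕP.*-monoˡ-≤ (r ^ 2) (x≢y∈p⇒2≤∣p∣ (p⊆p∪q ⁅ y ⁆ (x∈⁅x⁆ u)) (q⊆p∪q ⁅ u ⁆ ⁅ y ⁆ (x∈⁅x⁆ y)) u≢y) ⟩
          ∣ ⁅ u ⁆ ∪ ⁅ y ⁆ ∣ * r ^ 2     ∎)
        where
        open ≤-Reasoning
        u≢y : u ≢ y
        u≢y refl = y∉B (v∈Ball[v] u)

        -- Otherwise `N x` would contain both `u` and `y`, making them near.
        x≢w : x ≢ w
        x≢w refl = y∉B (Near⇒∈Ball (x , u∈Nw , Adj⇒∈N a))

        covered : Cover (⁅ u ⁆ ∪ ⁅ y ⁆) ⊆ Ball u ∪ Ball y
        covered {z} z∈ with x∈⋃⁻ (⁅ u ⁆ ∪ ⁅ y ⁆) Ball z∈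
        ... | t , t∈ , z∈Ball with x∈p∪q⁻ ⁅ u ⁆ ⁅ y ⁆ t∈
        ...   | inj₁ t∈u = x∈p∪q⁺ (inj₁ (subst (λ t → z ∈ Ball t) (x∈⁅y⁆⇒x≡y u t∈u) z∈Ball))
        ...   | inj₂ t∈y = x∈p∪q⁺ (inj₂ (subst (λ t → z ∈ Ball t) (x∈⁅y⁆⇒x≡y y t∈y) z∈Ball))

        x∈∩ : x ∈ Ball u ∩ Ball y
        x∈∩ = x∈p∩q⁺ (x∈B , Near⇒∈Ball (x , Adj⇒∈N a , v∈N[v] x))

        w∈∩ : w ∈ Ball u ∩ Ball y
        w∈∩ = x∈p∩q⁺ (Near⇒∈Ball (w , u∈Nw , v∈N[v] w) , Near⇒∈Ball (x , Adj⇒∈N a , ∈N-sym x∈Nw))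

        union-bound : ∣ Ball u ∪ Ball y ∣ + 2 ≤ 2 * r ^ 2 + 2
        union-bound = begin
          ∣ Ball u ∪ Ball y ∣ + 2                      ≤⟨ ℕP.+-monoʳ-≤ _ (x≢y∈p⇒2≤∣p∣ x∈∩ w∈∩ x≢w) ⟩
          ∣ Ball u ∪ Ball y ∣ + ∣ Ball u ∩ Ball y ∣    ≡⟨ ∣p∪q∣+∣p∩q∣≡∣p∣+∣q∣ (Ball u) (Ball y) ⟩
          ∣ Ball u ∣ + ∣ Ball y ∣                      ≤⟨ ℕP.+-mono-≤ (∣Ball∣≤1+r² u) (∣Ball∣≤1+r² y) ⟩
          (1 + r ^ 2) + (1 + r ^ 2)                    ≡⟨ cong ((1 + r ^ 2) +_) (ℕP.+-identityʳ _) ⟨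
          2 * (1 + r ^ 2)                              ≡⟨ ℕP.*-distribˡ-+ 2 1 (r ^ 2) ⟩
          2 + 2 * r ^ 2                                ≡⟨ ℕP.+-comm 2 _ ⟩
          2 * r ^ 2 + 2                                ∎

      all-near⇒n≤1+r² : Fin n → (∀ u v → Near u v) → n ≤ 1 + r ^ 2
      all-near⇒n≤1+r² v near = ℕP.≤-trans (all-∈⇒n≤∣p∣ λ x → Near⇒∈Ball (near v x)) (∣Ball∣≤1+r² v)

      -- It remains to see that distance 2 is attained. As `r` is at least 2, `1 + r` is below
      -- `1 + r ^ 2`, so some vertex lies outside `N v`.
      all-near⇒Moore : .{{_ : NonTrivial r}} → Fin n → (∀ u v → Near u v) → n ≡ 1 + r ^ 2 → IsMooreDiam2 G r
      all-near⇒Moore v near n≡1+r² = record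
        { regular  = regular
        ; diameter = (λ u w → Near⇒distance≤2 (near u w)) , v , proj₁ distant , isDistance-2 (near v _) (x∈∁p⇒x∉p (proj₂ distant))
        ; order    = n≡1+r²
        }
        where
        open ≤-Reasoning
        ∣N∣<n : 1 + r ℕ.< n
        ∣N∣<n = begin-strict
          1 + r             ≡⟨ cong suc (ℕP.*-identityʳ r) ⟨
          1 + r ^ 1         <⟨ s≤s (ℕP.^-monoʳ-< r (nonTrivial⇒n>1 r) (ℕP.n<1+n 1)) ⟩
          1 + r ^ 2         ≡⟨ n≡1+r² ⟨
          n                 ∎

        distant : Nonempty (∁ (N v))
        distant with nonempty? (∁ (N v))
        ... | yes nonempty = nonempty
        ... | no empty = ⊥-elim (ℕP.<⇒≱ ∣N∣<n (subst (n ≤_) (∣N∣≡1+r v)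
          (all-∈⇒n≤∣p∣ λ x → x∉∁p⇒x∈p λ x∈∁ → empty (x , x∈∁))))

      -- A finite search decides whether some ball misses a vertex, which gives a far pair to start
      -- from, or all vertices are pairwise near.
      large-packing : .{{_ : NonTrivial r}} → Fin n → ¬ IsMooreDiam2 G r → ∃[ T ] (Packing T × n ≤ ∣ T ∣ * r ^ 2)
      large-packing v ¬moore with any? (λ u → nonempty? (∁ (Ball u)))
      ... | yes (u , z , z∈∁) =
        let y , eff = efficient-pair (x∈∁p⇒x∉p z∈∁ ∘ Near⇒∈Ball)
        in extend (⊃-wellFounded _) (p⊆p∪q ⁅ y ⁆ (x∈⁅x⁆ u)) eff
      ... | no ¬far = ⁅ v ⁆ , Packing-⁅⁆ v , (begin
        -- Equality with `1 + r ^ 2` would make the graph Moore, so the bound drops by one.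
        n                    ≤⟨ ℕP.≤-pred (ℕP.≤∧≢⇒< (all-near⇒n≤1+r² v near) (¬moore ∘ all-near⇒Moore v near)) ⟩
        r ^ 2                ≡⟨ ℕP.*-identityˡ (r ^ 2) ⟨
        1 * r ^ 2            ≡⟨ cong (_* r ^ 2) (∣⁅x⁆∣≡1 v) ⟨
        ∣ ⁅ v ⁆ ∣ * r ^ 2    ∎)
        where
        open ≤-Reasoning
        near : ∀ u w → Near u w
        near u w = ∈Ball⇒Near (x∉∁p⇒x∈p λ w∈∁ → ¬far (u , w , w∈∁))

    -- Bounds for a minimum dominating set

    module Minimum {S : Subset n} (dom : IsTupleDominating G r S)
                   (minimal : ∀ S′ → IsTupleDominating G r S′ → ∣ S ∣ ≤ ∣ S′ ∣) where

      -- The complement of `T` is dominating and so competes with the minimum `S`.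
      ∣S∣+∣packing∣≤n : ∀ {T} → Packing T → ∣ S ∣ + ∣ T ∣ ≤ n
      ∣S∣+∣packing∣≤n {T} packing = begin
        ∣ S ∣ + ∣ T ∣      ≤⟨ ℕP.+-monoˡ-≤ _ (minimal (∁ T) (packing⇒dominating packing)) ⟩
        ∣ ∁ T ∣ + ∣ T ∣    ≡⟨ ℕP.+-comm ∣ ∁ T ∣ _ ⟩
        ∣ T ∣ + ∣ ∁ T ∣    ≡⟨ ∣p∣+∣∁p∣≡n T ⟩
        n                  ∎
        where open ≤-Reasoning

      -- Part (i) cleared of its denominator and of subtraction.
      non-Moore-bound : .{{_ : NonTrivial r}} → Fin n → (∀ u v → ∃[ k ] Walk G k u v) → ¬ IsMooreDiam2 G r →
        ∣ S ∣ * r ^ 2 + n ≤ n * r ^ 2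
      non-Moore-bound v connected ¬moore with large-packing connected v ¬moore
      ... | T , packing , large = begin
        ∣ S ∣ * r ^ 2 + n                  ≤⟨ ℕP.+-monoʳ-≤ _ large ⟩
        ∣ S ∣ * r ^ 2 + ∣ T ∣ * r ^ 2      ≡⟨ ℕP.*-distribʳ-+ (r ^ 2) ∣ S ∣ ∣ T ∣ ⟨
        (∣ S ∣ + ∣ T ∣) * r ^ 2            ≤⟨ ℕP.*-monoˡ-≤ (r ^ 2) (∣S∣+∣packing∣≤n packing) ⟩
        n * r ^ 2                          ∎
        where open ≤-Reasoning

      -- Above: a singleton is a packing. Below: all vertices are pairwise near, so the packing
      -- `∁ S` has at most one element.
      Moore⇒∣S∣≡r² : Fin n → IsMooreDiam2 G r → ∣ S ∣ ≡ r ^ 2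
      Moore⇒∣S∣≡r² v moore = ℕP.≤-antisym
        (ℕP.+-cancelʳ-≤ 1 _ _ (begin
          ∣ S ∣ + 1                ≡⟨ cong (∣ S ∣ +_) (∣⁅x⁆∣≡1 v) ⟨
          ∣ S ∣ + ∣ ⁅ v ⁆ ∣        ≤⟨ ∣S∣+∣packing∣≤n (Packing-⁅⁆ v) ⟩
          n                        ≡⟨ order ⟩
          1 + r ^ 2                ≡⟨ ℕP.+-comm 1 _ ⟩
          r ^ 2 + 1                ∎))
        (ℕP.+-cancelʳ-≤ 1 _ _ (begin
          r ^ 2 + 1                ≡⟨ ℕP.+-comm _ 1 ⟩
          1 + r ^ 2                ≡⟨ order ⟨
          n                        ≡⟨ ∣p∣+∣∁p∣≡n S ⟨
          ∣ S ∣ + ∣ ∁ S ∣          ≤⟨ ℕP.+-monoʳ-≤ _ (subsingleton⇒∣p∣≤1 (∁ S) λ x∈ y∈ → dominating⇒packing dom x∈ y∈ (near _ _)) ⟩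
          ∣ S ∣ + 1                ∎))
        where
        open ≤-Reasoning
        open IsMooreDiam2 moore using (diameter; order)
        near : ∀ u w → Near u w
        near u w = let _ , (walk , _) , e≤2 = proj₁ diameter u w in Walk≤2⇒Near e≤2 walk

    γ-exists : ∃[ S ] (IsTupleDominating G r S × (∀ S′ → IsTupleDominating G r S′ → ∣ S ∣ ≤ ∣ S′ ∣))
    γ-exists = smallestSubset (λ S → all? λ v → r ℕ.≤? ∣ N v ∩ S ∣)
      -- The search starts from the whole vertex set, written as the complement of the empty
      -- packing.
      (∁ ⊥ , packing⇒dominating λ x∈⊥ → ⊥-elim (∉⊥ x∈⊥))

-- Passing to rational numbers

open import Data.Integer as ℤ using (+_; 1ℤ)
import Data.Integer.Properties as ℤP
open import Data.Rational using (_/_; _*_; _≤_; toℚᵘ)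

-- Normalisation may cancel factors, so only equivalence holds. For `suc d` the fraction is
-- definitionally a `fromℚᵘ`.
toℚᵘ-/ : ∀ i d .{{_ : NonZero d}} → toℚᵘ (i / d) ℚᵘ.≃ i ℚᵘ./ d
toℚᵘ-/ i (suc d) = toℚᵘ-fromℚᵘ (ℚᵘ.mkℚᵘ i d)

toℚᵘ-/-* : ∀ i d n .{{_ : NonZero d}} → toℚᵘ ((i / d) * fromℕ n) ℚᵘ.≃ (i ℚᵘ./ d) ℚᵘ.* (+ n ℚᵘ./ 1)
toℚᵘ-/-* i d n = ℚᵘP.≃-trans (toℚᵘ-homo-* (i / d) (fromℕ n)) (ℚᵘP.*-cong (toℚᵘ-/ i d) (toℚᵘ-/ (+ n) 1))

cross-≤⇒fromℕ-≤ : ∀ m i d n .{{_ : NonZero d}} → + m ℤ.* + d ℤ.≤ i ℤ.* + n → fromℕ m ≤ (i / d) * fromℕ n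
cross-≤⇒fromℕ-≤ m i d@(suc d-1) n le = toℚᵘ-cancel-≤ (begin
  toℚᵘ (fromℕ m)                     ≃⟨ toℚᵘ-/ (+ m) 1 ⟩
  + m ℚᵘ./ 1                         ≤⟨ *≤* cross ⟩
  (i ℚᵘ./ d) ℚᵘ.* (+ n ℚᵘ./ 1)       ≃⟨ toℚᵘ-/-* i d n ⟨
  toℚᵘ ((i / d) * fromℕ n)           ∎)
  where
  open ℚᵘP.≤-Reasoning
  -- The factors `+ 1` are the denominators of `fromℕ n` and `fromℕ m`.
  cross : + m ℤ.* (+ d ℤ.* + 1) ℤ.≤ (i ℤ.* + n) ℤ.* + 1
  cross = subst₂ ℤ._≤_ (cong (+ m ℤ.*_) (sym (ℤP.*-identityʳ (+ d)))) (sym (ℤP.*-identityʳ (i ℤ.* + n))) le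

cross-≡⇒fromℕ-≡ : ∀ m i d n .{{_ : NonZero d}} → + m ℤ.* + d ≡ i ℤ.* + n → fromℕ m ≡ (i / d) * fromℕ n
cross-≡⇒fromℕ-≡ m i d@(suc d-1) n eq = toℚᵘ-injective (begin
  toℚᵘ (fromℕ m)                     ≈⟨ toℚᵘ-/ (+ m) 1 ⟩
  + m ℚᵘ./ 1                         ≈⟨ *≡* cross ⟩
  (i ℚᵘ./ d) ℚᵘ.* (+ n ℚᵘ./ 1)       ≈⟨ toℚᵘ-/-* i d n ⟨
  toℚᵘ ((i / d) * fromℕ n)           ∎)
  where
  open import Relation.Binary.Reasoning.Setoid ℚᵘP.≃-setoid
  cross : + m ℤ.* (+ d ℤ.* + 1) ≡ (i ℤ.* + n) ℤ.* + 1
  cross = trans (cong (+ m ℤ.*_) (ℤP.*-identityʳ (+ d))) (trans eq (sym (ℤP.*-identityʳ (i ℤ.* + n))))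

-- Subtract `n` from both sides in the integers and factor the right-hand side.
m*q+n≤n*q⇒m*q≤[q-1]*n : ∀ m n q → m ℕ.* q ℕ.+ n ℕ.≤ n ℕ.* q → + m ℤ.* + q ℤ.≤ (+ q ℤ.- 1ℤ) ℤ.* + n
m*q+n≤n*q⇒m*q≤[q-1]*n m n q le = begin
  + m ℤ.* + q                              ≡⟨ ℤP.pos-* m q ⟨
  + (m ℕ.* q)                              ≡⟨ ℤP.+-identityʳ _ ⟨
  + (m ℕ.* q) ℤ.+ ℤ.0ℤ                     ≡⟨ cong (ℤ._+_ (+ (m ℕ.* q))) (ℤP.+-inverseʳ (+ n)) ⟨
  + (m ℕ.* q) ℤ.+ (+ n ℤ.- + n)            ≡⟨ ℤP.+-assoc (+ (m ℕ.* q)) (+ n) (ℤ.- + n) ⟨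
  + (m ℕ.* q ℕ.+ n) ℤ.- + n                ≤⟨ ℤP.+-monoˡ-≤ (ℤ.- + n) (ℤ.+≤+ le) ⟩
  + (n ℕ.* q) ℤ.- + n                      ≡⟨ cong₂ ℤ._+_ (trans (cong +_ (ℕP.*-comm n q)) (ℤP.pos-* q n)) (sym (ℤP.-1*i≡-i (+ n))) ⟩
  + q ℤ.* + n ℤ.+ ℤ.- 1ℤ ℤ.* + n           ≡⟨ ℤP.*-distribʳ-+ (+ n) (+ q) (ℤ.- 1ℤ) ⟨
  (+ q ℤ.- 1ℤ) ℤ.* + n                     ∎
  where open ℤP.≤-Reasoning

vertex : ∀ {n} .{{_ : NonZero n}} → Fin n
vertex {suc _} = zero

theorem5 : (r : ℕ) .{{_ : NonTrivial r}} (n : ℕ) (G : Graph n) →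
    Connected G → Regular G r →
    ∃[ γ ] (IsTupleDominationNumber G r γ
    × (¬ IsMooreDiam2 G r →
    fromℕ γ ≤ ((+ (r ^ 2) ℤ.- 1ℤ) / (r ^ 2)) * fromℕ n)
    × (IsMooreDiam2 G r →
    (fromℕ γ ≡ ((+ (r ^ 2)) / (1 ℕ.+ r ^ 2)) * fromℕ n)
    × (γ ≡ r ^ 2)))
theorem5 r n G (n≢0 , connected) regular with γ-exists G regular
... | S , dom , minimal =
  ∣ S ∣ , ((S , dom , refl) , minimal) ,
  (λ ¬moore → cross-≤⇒fromℕ-≤ ∣ S ∣ (+ (r ^ 2) ℤ.- 1ℤ) (r ^ 2) n
    (m*q+n≤n*q⇒m*q≤[q-1]*n ∣ S ∣ n (r ^ 2) (non-Moore-bound v connected ¬moore))) ,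
  -- Cross-multiplied, the claim equates two products whose factors agree in order.
  λ moore → cross-≡⇒fromℕ-≡ ∣ S ∣ (+ (r ^ 2)) (1 ℕ.+ r ^ 2) n
      (cong₂ (λ a b → + a ℤ.* + b) (Moore⇒∣S∣≡r² v moore) (sym (IsMooreDiam2.order moore))) ,
    Moore⇒∣S∣≡r² v moore
  where
  open Minimum G regular dom minimal
  v : Fin n
  v = vertex {{n≢0}}
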